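{- For every positive integer $n\neq 5$, the maximum number of edges in an $n$-vertex graph containing no subgraph isomorphic to $T$ is $$\mathrm{ex}(n,T)=\begin{cases}\left\lfloor \frac{n^2}{4}\right\rfloor+\left\lfloor\frac n2\right\rfloor, & n\not\equiv 2 \pmod 4,\\[2pt] \frac{n^2}{4}+\frac n2-1, & n\equiv 2\pmod 4.\end{cases}$$
   Context: All graphs are finite, simple and undirected. $T$ (the flattened tetrahedron) is the graph on six vertices $a,b,c,d,e,f$ with the nine edges $bc, ce, eb, ab, ac, bd, de, cf, fe$; i.e. a triangle $bce$ with a further triangle erected on each of its three edges. $\mathrm{ex}(n,H)$ is the maximum number of edges in an $n$-vertex graph not containing $H$ as a subgraph. -}

module Defs where

open import Data.Nat using (ℕ; zero; suc; _+_; _*_; _∸_; _≤_; _<_; _<ᵇ_)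
open import Data.Nat.DivMod using (_/_; _%_)
open import Data.Bool using (Bool; true; false; _∧_; if_then_else_)
open import Data.Fin using (Fin; toℕ)
open import Data.Fin.Patterns using (0F; 1F; 2F; 3F; 4F; 5F)
open import Data.List using (List; []; _∷_; allFin; map)
open import Data.Nat.ListAction using (sum)
open import Data.Empty using (⊥)
open import Data.Product using (Σ; _×_; _,_; ∃)
open import Relation.Binary.PropositionalEquality using (_≡_; _≢_)
open import Function.Definitions using (Injective)

record Graph (n : ℕ) : Set where
  field
    adj   : Fin n → Fin n → Bool
    sym   : ∀ i j → adj i j ≡ adj j i
    irref : ∀ i → adj i i ≡ false
open Graph public

edgeCount : ∀ {n} → Graph n → ℕ
edgeCount {n} G =
  sum (map (λ i → sum (map (λ j →
        if (toℕ i <ᵇ toℕ j) ∧ adj G i j then 1 else 0) (allFin n))) (allFin n))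

_⊆ᴳ_ : ∀ {k n} → Graph k → Graph n → Set
_⊆ᴳ_ {k} {n} H G =
  Σ (Fin k → Fin n) λ f → Injective _≡_ _≡_ f ×
    (∀ i j → adj H i j ≡ true → adj G (f i) (f j) ≡ true)

IsEx : ∀ {k} → ℕ → Graph k → ℕ → Set
IsEx n H m =
  (Σ (Graph n) λ G → (H ⊆ᴳ G → ⊥) × edgeCount G ≡ m) ×
  (∀ (G : Graph n) → (H ⊆ᴳ G → ⊥) → edgeCount G ≤ m)

-- The flattened tetrahedron T on vertices a b c d e f = 0 1 2 3 4 5,
-- edges bc ce eb ab ac bd de cf fe.
T-edge : Fin 6 → Fin 6 → Bool
T-edge 1F 2F = true
T-edge 2F 4F = true
T-edge 4F 1F = true
T-edge 0F 1F = true
T-edge 0F 2F = true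
T-edge 1F 3F = true
T-edge 3F 4F = true
T-edge 2F 5F = true
T-edge 5F 4F = true
T-edge _ _ = false

T-adj : Fin 6 → Fin 6 → Bool
T-adj i j = if T-edge i j then true else T-edge j i

T-sym : ∀ i j → T-adj i j ≡ T-adj j i
T-sym 0F 0F = _≡_.refl
T-sym 0F 1F = _≡_.refl
T-sym 0F 2F = _≡_.refl
T-sym 0F 3F = _≡_.refl
T-sym 0F 4F = _≡_.refl
T-sym 0F 5F = _≡_.refl
T-sym 1F 0F = _≡_.refl
T-sym 1F 1F = _≡_.refl
T-sym 1F 2F = _≡_.refl
T-sym 1F 3F = _≡_.refl
T-sym 1F 4F = _≡_.refl
T-sym 1F 5F = _≡_.refl
T-sym 2F 0F = _≡_.refl
T-sym 2F 1F = _≡_.refl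
T-sym 2F 2F = _≡_.refl
T-sym 2F 3F = _≡_.refl
T-sym 2F 4F = _≡_.refl
T-sym 2F 5F = _≡_.refl
T-sym 3F 0F = _≡_.refl
T-sym 3F 1F = _≡_.refl
T-sym 3F 2F = _≡_.refl
T-sym 3F 3F = _≡_.refl
T-sym 3F 4F = _≡_.refl
T-sym 3F 5F = _≡_.refl
T-sym 4F 0F = _≡_.refl
T-sym 4F 1F = _≡_.refl
T-sym 4F 2F = _≡_.refl
T-sym 4F 3F = _≡_.refl
T-sym 4F 4F = _≡_.refl
T-sym 4F 5F = _≡_.refl
T-sym 5F 0F = _≡_.refl
T-sym 5F 1F = _≡_.refl
T-sym 5F 2F = _≡_.refl
T-sym 5F 3F = _≡_.refl
T-sym 5F 4F = _≡_.refl
T-sym 5F 5F = _≡_.refl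

T-irr : ∀ i → T-adj i i ≡ false
T-irr 0F = _≡_.refl
T-irr 1F = _≡_.refl
T-irr 2F = _≡_.refl
T-irr 3F = _≡_.refl
T-irr 4F = _≡_.refl
T-irr 5F = _≡_.refl

T : Graph 6
T = record { adj = T-adj ; sym = T-sym ; irref = T-irr }

exT : ℕ → ℕ
exT n with n % 4
... | 2 = n * n / 4 + n / 2 ∸ 1
... | _ = n * n / 4 + n / 2

{-# OPTIONS --safe #-}

-- The values f(n) = exT n satisfy f(n) = f(n-4) + 2n - 2.
--
-- Lower bound: K_{a,b} with a matching inside each side is T-free, because
-- every triangle has two matched vertices and a third vertex e on the other
-- side, and the two triangles over the sides through e would share as apex
-- the matching partner of e.
--
-- Upper bound, by induction on the number of vertices.  If G contains K₅ minus
-- an edge, an outer vertex sees at most two of its five vertices (one if it is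
-- a K₅), and these five are deleted; the exceptional value ex(5) = 10 is still
-- good enough for n = 10.  If G has no K₅⁻, the claim holds for n = 5 as well:
-- an outer vertex sees at most two vertices of a K₄, which is then deleted.
-- If G has no K₄, further apexes over the three sides of a triangle are
-- distinct, so T-freeness means that every triangle has a side lying in no other
-- triangle.  Hence, unless G is edgeless, some edge xy lies in at most one
-- triangle and d(x) + d(y) ≤ n + 1; delete x or y if its degree is at most n/2,
-- and both otherwise.

module Submission where

open import Defs renaming (sym to adj-sym)
open import Data.Nat using (ℕ; zero; suc; _+_; _*_; _∸_; _≤_; z≤n; s≤s; _<ᵇ_; ⌊_/2⌋; ⌈_/2⌉)
open import Data.Nat.Properties as ℕ hiding (_≟_)
open import Algebra.Properties.CommutativeSemigroup +-commutativeSemigroup using (interchange)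
open import Data.Nat.DivMod using (_/_; _%_; +-distrib-/-∣ʳ; m*n/n≡m; m/n≡1+[m∸n]/n)
open import Data.Nat.Divisibility using (divides)
open import Data.Nat.ListAction using (sum)
open import Data.Nat.ListAction.Properties using (sum-↭)
open import Data.Nat.Tactic.RingSolver using (solve-∀)
open import Data.Bool using (Bool; true; false; _∧_; _∨_; _xor_; if_then_else_)
open import Data.Bool.Properties using (_≟_; ¬-not; xor-same; xor-comm)
open import Data.Fin using (Fin; zero; suc; toℕ)
import Data.Fin.Properties as Fin
open import Data.Fin.Patterns using (0F; 1F; 2F; 3F; 4F; 5F)
open import Data.List using (List; []; _∷_; _++_; length; map; allFin; tabulate)
open import Data.List.Properties using (map-tabulate; length-tabulate; map-cong; map-∘)
open import Data.List.Membership.Propositional using (_∈_; find; lose)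
open import Data.List.Membership.Propositional.Properties using (∈-∃++; ∈-++⁺ˡ; ∈-++⁺ʳ)
import Data.List.Membership.DecPropositional as DecMembership
open import Data.List.Relation.Binary.Permutation.Propositional using (_↭_; prep; swap; ↭-refl; ↭-sym; ↭-trans; ↭⇒↭ₛ)
open import Data.List.Relation.Binary.Permutation.Propositional.Properties using (shift; map⁺; ↭-length; ∈-resp-↭)
import Data.List.Relation.Binary.Permutation.Setoid.Properties as SetoidPerm
open import Data.List.Relation.Unary.All as All using (All; []; _∷_)
open import Data.List.Relation.Unary.Any using (here; there; any?)
open import Data.List.Relation.Unary.AllPairs using (AllPairs; []; _∷_)
open import Data.List.Relation.Unary.Unique.Propositional using (Unique)
open import Data.List.Relation.Unary.Unique.Propositional.Properties using (allFin⁺)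
open import Data.Vec as Vec using ([]; _∷_)
import Data.Vec.Relation.Unary.All as VecAll
import Data.Vec.Relation.Unary.AllPairs as VecPairs
import Data.Vec.Relation.Unary.Unique.Propositional as VecUnique
import Data.Vec.Relation.Unary.Unique.Propositional.Properties as VecUnique
open import Data.Product using (∃; ∃₂; _×_; _,_)
open import Data.Product.Properties using (≡-dec)
open import Data.Sum using (_⊎_; inj₁; inj₂)
open import Data.Empty using (⊥; ⊥-elim)
open import Function using (_∘_; id; _$_)
open import Relation.Nullary using (¬_; Dec; yes; no; ¬?; _×-dec_; _→-dec_)
open import Relation.Nullary.Decidable using (map′; from-yes)
open import Relation.Binary.PropositionalEquality

-- The extremal numbers: a recursion in steps of four and the increments used by the inductions.

-- Free of division and residues, so inequalities between values follow by induction in steps of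
-- four.
F : ℕ → ℕ
F 0 = 0
F 1 = 0
F 2 = 1
F 3 = 3
F (suc (suc (suc (suc n)))) = F n + (2 * n + 6)

/2-step : ∀ n → (4 + n) / 2 ≡ n / 2 + 2
/2-step n = trans (cong (_/ 2) (+-comm 4 n)) (+-distrib-/-∣ʳ n (divides 2 refl))

square/4-step : ∀ n → (4 + n) * (4 + n) / 4 ≡ n * n / 4 + (2 * n + 4)
square/4-step n = begin
  (4 + n) * (4 + n) / 4           ≡⟨ cong (_/ 4) (expand n) ⟩
  (n * n + (2 * n + 4) * 4) / 4   ≡⟨ +-distrib-/-∣ʳ (n * n) (divides (2 * n + 4) refl) ⟩
  n * n / 4 + (2 * n + 4) * 4 / 4 ≡⟨ cong (n * n / 4 +_) (m*n/n≡m (2 * n + 4) 4) ⟩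
  n * n / 4 + (2 * n + 4)         ∎
  where
  open ≡-Reasoning
  expand : ∀ n → (4 + n) * (4 + n) ≡ n * n + (2 * n + 4) * 4
  expand = solve-∀

numerator-step : ∀ n → (4 + n) * (4 + n) / 4 + (4 + n) / 2 ≡ n * n / 4 + n / 2 + (2 * n + 6)
numerator-step n = trans (cong₂ _+_ (square/4-step n) (/2-step n)) (rearrange (n * n / 4) (n / 2) n)
  where
  rearrange : ∀ a b n → a + (2 * n + 4) + (b + 2) ≡ a + b + (2 * n + 6)
  rearrange = solve-∀

-- Guards the truncated `∸ 1` in `exT`: with a positive minuend it commutes with adding the
-- increment.
1≤n/2 : ∀ n → n % 4 ≡ 2 → 1 ≤ n / 2
1≤n/2 (suc (suc n)) _ = subst (1 ≤_) (sym (m/n≡1+[m∸n]/n {2 + n} {2} (s≤s (s≤s z≤n)))) (s≤s z≤n)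

exT-step : ∀ n → exT (4 + n) ≡ exT n + (2 * n + 6)
-- `(4 + n) % 4` computes to `n % 4`, so this one split unfolds `exT` on both sides.
exT-step n with n % 4 in eq
... | 0 = numerator-step n
... | 1 = numerator-step n
... | 2 = trans (cong (_∸ 1) (numerator-step n))
                (+-∸-comm (2 * n + 6) (≤-trans (1≤n/2 n eq) (m≤n+m _ (n * n / 4))))
... | suc (suc (suc _)) = numerator-step n

F≡exT : ∀ n → F n ≡ exT n
F≡exT 0 = refl
F≡exT 1 = refl
F≡exT 2 = refl
F≡exT 3 = refl
F≡exT (suc (suc (suc (suc n)))) = trans (cong (_+ (2 * n + 6)) (F≡exT n)) (sym (exT-step n))

-- The claim fails at `0`, where `F 0` and `F 1` agree. Hence 4 is treated as a base case: the
-- recursion would lead from it back to 0.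
F-increasing : ∀ n → 1 ≤ n → 1 + F n ≤ F (1 + n)
F-increasing 1 _ = s≤s z≤n
F-increasing 2 _ = s≤s (s≤s z≤n)
F-increasing 3 _ = s≤s (s≤s (s≤s (s≤s z≤n)))
F-increasing 4 _ = m≤m+n 7 1
F-increasing (suc (suc (suc (suc n@(suc _))))) _ =
  +-mono-≤ (F-increasing n (s≤s z≤n)) (+-monoˡ-≤ 6 (*-monoʳ-≤ 2 (n≤1+n n)))

-- Pays for deleting one endpoint of an edge: the edge itself, at most `⌊ n /2⌋` edges to the `n`
-- other vertices, and what remains on `1 + n` vertices.
F-step₁ : ∀ n → 1 + ⌊ n /2⌋ + F (1 + n) ≤ F (2 + n)
F-step₁ 0 = ≤-refl
F-step₁ 1 = m≤m+n 2 1
F-step₁ 2 = m≤m+n 5 1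
F-step₁ 3 = ≤-refl
F-step₁ (suc (suc (suc (suc n)))) = begin
  3 + ⌊ n /2⌋ + (F (1 + n) + (2 * (1 + n) + 6)) ≡⟨ rearrange ⌊ n /2⌋ (F (1 + n)) n ⟩
  1 + ⌊ n /2⌋ + F (1 + n) + (2 * (2 + n) + 6)   ≤⟨ +-monoˡ-≤ _ (F-step₁ n) ⟩
  F (2 + n) + (2 * (2 + n) + 6)                 ∎
  where
  open ≤-Reasoning
  rearrange : ∀ h a n → 3 + h + (a + (2 * (1 + n) + 6)) ≡ 1 + h + a + (2 * (2 + n) + 6)
  rearrange = solve-∀

-- Pays for deleting both endpoints of an edge: the edge itself and at most `2 * ⌈ n /2⌉` edges to
-- the `n` other vertices.
F-step₂ : ∀ n → 1 + 2 * ⌈ n /2⌉ + F n ≤ F (2 + n)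
F-step₂ 0 = ≤-refl
F-step₂ 1 = ≤-refl
F-step₂ 2 = m≤m+n 4 2
F-step₂ 3 = ≤-refl
F-step₂ (suc (suc (suc (suc n)))) = begin
  1 + 2 * (2 + ⌈ n /2⌉) + (F n + (2 * n + 6)) ≡⟨ rearrange ⌈ n /2⌉ (F n) n ⟩
  1 + 2 * ⌈ n /2⌉ + F n + (2 * (2 + n) + 6)   ≤⟨ +-monoˡ-≤ _ (F-step₂ n) ⟩
  F (2 + n) + (2 * (2 + n) + 6)               ∎
  where
  open ≤-Reasoning
  rearrange : ∀ h a n → 1 + 2 * (2 + h) + (a + (2 * n + 6)) ≡ 1 + 2 * h + a + (2 * (2 + n) + 6)
  rearrange = solve-∀

-- If both `p` and `q` exceed `⌊ r /2⌋`, their sum forces `1 + ⌊ r /2⌋ ≤ ⌈ r /2⌉`, and `1 + r` is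
-- then at most `2 * ⌈ r /2⌉`. The three outcomes match the three possible deletions at a light
-- edge.
small-or-≤⌈/2⌉ : ∀ r {p q} → p + q ≤ 1 + r → p ≤ ⌊ r /2⌋ ⊎ q ≤ ⌊ r /2⌋ ⊎ p + q ≤ 2 * ⌈ r /2⌉
small-or-≤⌈/2⌉ r {p} {q} p+q≤ with p ≤? ⌊ r /2⌋ | q ≤? ⌊ r /2⌋
... | yes p≤ | _      = inj₁ p≤
... | no _   | yes q≤ = inj₂ (inj₁ q≤)
... | no p≰  | no q≰  = inj₂ (inj₂ (begin
  p + q                   ≤⟨ p+q≤halves ⟩
  1 + ⌊ r /2⌋ + ⌈ r /2⌉   ≤⟨ +-monoˡ-≤ ⌈ r /2⌉ (+-cancelˡ-≤ (1 + ⌊ r /2⌋) _ _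
                               (≤-trans (+-mono-≤ (≰⇒> p≰) (≰⇒> q≰)) p+q≤halves)) ⟩
  ⌈ r /2⌉ + ⌈ r /2⌉       ≡⟨ cong (⌈ r /2⌉ +_) (+-identityʳ ⌈ r /2⌉) ⟨
  2 * ⌈ r /2⌉             ∎))
  where
  open ≤-Reasoning
  p+q≤halves : p + q ≤ 1 + ⌊ r /2⌋ + ⌈ r /2⌉
  p+q≤halves = ≤-trans p+q≤ (≤-reflexive (cong suc (sym (⌊n/2⌋+⌈n/2⌉≡n r))))

-- Counting edges inside and between lists of vertices

indicator : Bool → ℕ
indicator b = if b then 1 else 0

indicator≤1 : ∀ b → indicator b ≤ 1
indicator≤1 false = z≤n
indicator≤1 true  = ≤-refl

module _ {A : Set} where

  sum-map-≤ : ∀ {f : A → ℕ} c xs → (∀ {x} → x ∈ xs → f x ≤ c) → sum (map f xs) ≤ c * length xs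
  sum-map-≤ c []       f≤c = z≤n
  sum-map-≤ c (x ∷ xs) f≤c =
    ≤-trans (+-mono-≤ (f≤c (here refl)) (sum-map-≤ c xs (f≤c ∘ there))) (≤-reflexive (sym (*-suc c (length xs))))

  sum-map-+ : ∀ (f g : A → ℕ) xs → sum (map (λ x → f x + g x) xs) ≡ sum (map f xs) + sum (map g xs)
  sum-map-+ f g []       = refl
  sum-map-+ f g (x ∷ xs) =
    trans (cong (f x + g x +_) (sum-map-+ f g xs)) (interchange (f x) (g x) _ _)

  sum-map-0 : ∀ {f : A → ℕ} xs → (∀ {x} → x ∈ xs → f x ≡ 0) → sum (map f xs) ≡ 0
  sum-map-0 []       f≡0 = refl
  sum-map-0 (x ∷ xs) f≡0 = cong₂ _+_ (f≡0 (here refl)) (sum-map-0 xs (f≡0 ∘ there))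

-- The binomial coefficient `n` choose 2, the size of a complete graph.
tri : ℕ → ℕ
tri zero    = 0
tri (suc n) = n + tri n

module Counting {A : Set} (_~_ : A → A → Bool) where

  degree : A → List A → ℕ
  degree x ys = sum (map (λ y → indicator (x ~ y)) ys)

  edges : List A → ℕ
  edges []       = 0
  edges (x ∷ xs) = degree x xs + edges xs

  edgesBetween : List A → List A → ℕ
  edgesBetween xs ys = sum (map (λ x → degree x ys) xs)

  degree-++ : ∀ x ys zs → degree x (ys ++ zs) ≡ degree x ys + degree x zs
  degree-++ x []       zs = refl
  degree-++ x (y ∷ ys) zs =
    trans (cong (indicator (x ~ y) +_) (degree-++ x ys zs)) (sym (+-assoc (indicator (x ~ y)) _ _))

  edges-++ : ∀ xs ys → edges (xs ++ ys) ≡ edges xs + edgesBetween xs ys + edges ys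
  edges-++ []       ys = refl
  edges-++ (x ∷ xs) ys =
    trans (cong₂ _+_ (degree-++ x xs ys) (edges-++ xs ys))
          (rearrange (degree x xs) (degree x ys) (edges xs) (edgesBetween xs ys) (edges ys))
    where
    rearrange : ∀ a b c d e → a + b + (c + d + e) ≡ a + c + (b + d) + e
    rearrange = solve-∀

  degree≤length : ∀ x ys → degree x ys ≤ length ys
  degree≤length x ys =
    ≤-trans (sum-map-≤ 1 ys (λ {y} _ → indicator≤1 (x ~ y))) (≤-reflexive (+-identityʳ _))

  edges≤tri : ∀ xs → edges xs ≤ tri (length xs)
  edges≤tri []       = z≤n
  edges≤tri (x ∷ xs) = +-mono-≤ (degree≤length x xs) (edges≤tri xs)

  edgesBetween-∷ : ∀ xs y ys → edgesBetween xs (y ∷ ys) ≡ sum (map (λ x → indicator (x ~ y)) xs) + edgesBetween xs ys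
  edgesBetween-∷ xs y ys = sum-map-+ (λ x → indicator (x ~ y)) (λ x → degree x ys) xs

  module Symmetric (~-sym : ∀ x y → x ~ y ≡ y ~ x) where

    edgesBetween-comm : ∀ xs ys → edgesBetween xs ys ≡ edgesBetween ys xs
    edgesBetween-comm xs []       = sum-map-0 xs (λ _ → refl)
    edgesBetween-comm xs (y ∷ ys) = trans (edgesBetween-∷ xs y ys)
      (cong₂ _+_ (cong sum (map-cong (λ x → cong indicator (~-sym x y)) xs)) (edgesBetween-comm xs ys))

    edgesBetween≤ : ∀ {c} xs ys → (∀ {y} → y ∈ ys → degree y xs ≤ c) → edgesBetween xs ys ≤ c * length ys
    edgesBetween≤ {c} xs ys d≤c =
      ≤-trans (≤-reflexive (edgesBetween-comm xs ys)) (sum-map-≤ c ys d≤c)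

    edges-↭ : ∀ {xs ys} → xs ↭ ys → edges xs ≡ edges ys
    edges-↭ _↭_.refl        = refl
    edges-↭ (prep x p)      = cong₂ _+_ (sum-↭ (map⁺ _ p)) (edges-↭ p)
    edges-↭ (swap {xs} {ys} x y p) = begin
      indicator (x ~ y) + degree x xs + (degree y xs + edges xs)
        ≡⟨ cong₂ (λ i d → indicator i + d + (degree y xs + edges xs)) (~-sym x y) (sum-↭ (map⁺ _ p)) ⟩
      indicator (y ~ x) + degree x ys + (degree y xs + edges xs)
        ≡⟨ cong₂ (λ d e → indicator (y ~ x) + degree x ys + (d + e)) (sum-↭ (map⁺ _ p)) (edges-↭ p) ⟩
      indicator (y ~ x) + degree x ys + (degree y ys + edges ys)
        ≡⟨ interchange (indicator (y ~ x)) (degree x ys) (degree y ys) (edges ys) ⟩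
      indicator (y ~ x) + degree y ys + (degree x ys + edges ys) ∎
      where open ≡-Reasoning
    edges-↭ (_↭_.trans p q) = trans (edges-↭ p) (edges-↭ q)

open Counting

edges-map : ∀ {A B : Set} (_~_ : B → B → Bool) (g : A → B) xs →
            edges _~_ (map g xs) ≡ edges (λ x y → g x ~ g y) xs
edges-map _~_ g []       = refl
edges-map _~_ g (x ∷ xs) = cong₂ _+_ (cong sum (sym (map-∘ xs))) (edges-map _~_ g xs)

sum-allFin : ∀ {n} (f : Fin (suc n) → ℕ) →
             sum (map f (allFin (suc n))) ≡ f zero + sum (map (f ∘ suc) (allFin n))
sum-allFin {n} f = cong (λ l → f zero + sum l)
  (trans (map-tabulate suc f) (sym (map-tabulate id (f ∘ suc))))

-- Induction splitting off vertex `zero`: its row is its degree into the later vertices, its column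
-- vanishes because nothing is below 0, and the rest is the same sum for the relation shifted by
-- `suc`.
edgeSum≡edges : ∀ {n} (_~_ : Fin n → Fin n → Bool) →
  sum (map (λ i → sum (map (λ j → indicator ((toℕ i <ᵇ toℕ j) ∧ (i ~ j))) (allFin n))) (allFin n))
  ≡ edges _~_ (allFin n)
edgeSum≡edges {zero}  _~_ = refl
edgeSum≡edges {suc n} _~_ = begin
  sum (map (λ i → sum (map (entry i) (allFin (suc n)))) (allFin (suc n)))
    ≡⟨ sum-allFin (λ i → sum (map (entry i) (allFin (suc n)))) ⟩
  sum (map (entry zero) (allFin (suc n))) + sum (map (λ i → sum (map (entry (suc i)) (allFin (suc n)))) (allFin n))
    ≡⟨ cong₂ _+_ (sum-allFin (entry zero)) (cong sum (map-cong (λ i → sum-allFin (entry (suc i))) (allFin n))) ⟩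
  sum (map (entry zero ∘ suc) (allFin n)) + sum (map (λ i → sum (map (entry (suc i) ∘ suc) (allFin n))) (allFin n))
    ≡⟨ cong₂ _+_ (cong sum first-row) (edgeSum≡edges (λ i j → suc i ~ suc j)) ⟩
  degree _~_ zero (tabulate suc) + edges (λ i j → suc i ~ suc j) (allFin n)
    ≡⟨ cong (degree _~_ zero (tabulate suc) +_) (edges-map _~_ suc (allFin n)) ⟨
  degree _~_ zero (tabulate suc) + edges _~_ (map suc (allFin n))
    ≡⟨ cong (λ l → degree _~_ zero (tabulate suc) + edges _~_ l) (map-tabulate id suc) ⟩
  edges _~_ (allFin (suc n))
    ∎
  where
  open ≡-Reasoning
  entry : Fin (suc n) → Fin (suc n) → ℕ
  entry i j = indicator ((toℕ i <ᵇ toℕ j) ∧ (i ~ j))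
  first-row : map (λ j → indicator (zero ~ suc j)) (allFin n) ≡ map (λ j → indicator (zero ~ j)) (tabulate suc)
  first-row = trans (map-tabulate {n = n} id (λ j → indicator (zero ~ suc j)))
                    (sym (map-tabulate {n = n} suc (λ j → indicator (zero ~ j))))

edgeCount≡edges : ∀ {n} (G : Graph n) → edgeCount G ≡ edges (adj G) (allFin n)
edgeCount≡edges G = edgeSum≡edges (adj G)

-- Lists of distinct elements

module _ {A : Set} where

  Unique-resp-↭ : {xs ys : List A} → xs ↭ ys → Unique xs → Unique ys
  Unique-resp-↭ p = SetoidPerm.Unique-resp-↭ (setoid A) (↭⇒↭ₛ p)

  -- Turns the deletion of a configuration found anywhere in `L` into dropping a prefix; edge counts
  -- are invariant under the permutation.
  extract : ∀ {xs L : List A} → Unique xs → All (_∈ L) xs → ∃ λ R → L ↭ xs ++ R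
  extract [] [] = _ , ↭-refl
  extract {x ∷ xs} (x∉xs ∷ xs!) (x∈L ∷ xs∈L) with ∈-∃++ x∈L
  ... | us , vs , refl with extract xs! (All.zipWith survives (x∉xs , xs∈L))
    where
    survives : ∀ {y} → (x ≢ y) × y ∈ us ++ x ∷ vs → y ∈ us ++ vs
    survives (x≢y , y∈L) with ∈-resp-↭ (shift x us vs) y∈L
    ... | here y≡x = ⊥-elim (x≢y (sym y≡x))
    ... | there y∈ = y∈
  ... | R , p = R , ↭-trans (shift x us vs) (prep x p)

  Unique-++⇒disjoint : ∀ (xs : List A) {R u} → Unique (xs ++ R) → u ∈ R → All (u ≢_) xs
  Unique-++⇒disjoint []       _           _   = []
  Unique-++⇒disjoint (x ∷ xs) (x∉ ∷ rest) u∈R =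
    (λ u≡x → All.lookup x∉ (∈-++⁺ʳ xs u∈R) (sym u≡x)) ∷ Unique-++⇒disjoint xs rest u∈R

  Unique-++⇒Uniqueʳ : ∀ (xs : List A) {R} → Unique (xs ++ R) → Unique R
  Unique-++⇒Uniqueʳ []       R! = R!
  Unique-++⇒Uniqueʳ (x ∷ xs) (_ ∷ rest) = Unique-++⇒Uniqueʳ xs rest

  ∃∈? : ∀ {P : A → Set} → (∀ x → Dec (P x)) → ∀ L → Dec (∃ λ x → x ∈ L × P x)
  ∃∈? P? L = map′ find (λ (_ , x∈L , px) → lose x∈L px) (any? P? L)

-- The upper bound

T-edges : List (Fin 6 × Fin 6)
T-edges = (0F , 1F) ∷ (0F , 2F) ∷ (1F , 2F) ∷ (1F , 3F) ∷ (3F , 4F) ∷ (4F , 1F) ∷ (2F , 5F) ∷ (5F , 4F) ∷ (2F , 4F) ∷ []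

-- Decided over all 36 pairs, so an embedding of `T` has to exhibit only nine adjacencies.
T-edge⇒∈ : ∀ i j → T-edge i j ≡ true → (i , j) ∈ T-edges
T-edge⇒∈ = from-yes (Fin.all? λ i → Fin.all? λ j → (T-edge i j ≟ true) →-dec ((i , j) ∈? T-edges))
  where open DecMembership (≡-dec Fin._≟_ Fin._≟_) using (_∈?_)

module UpperBound {n} (G : Graph n) (T-free : T ⊆ᴳ G → ⊥) where

  open Symmetric (adj G) (adj-sym G)

  infix 5 _—_
  _—_ : Fin n → Fin n → Set
  x — y = adj G x y ≡ true

  —-sym : ∀ {x y} → x — y → y — x
  —-sym {x} {y} = trans (adj-sym G y x)

  —⇒≢ : ∀ {x y} → x — y → x ≢ y
  —⇒≢ {x} x—y refl with trans (sym x—y) (irref G x)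
  ... | ()

  _—?_ : ∀ x y → Dec (x — y)
  x —? y = adj G x y ≟ true

  Apex : Fin n → Fin n → Fin n → Fin n → Set
  Apex a x y z = x — a × y — a × a ≢ z

  Triangle : Fin n → Fin n → Fin n → Set
  Triangle x y z = x — y × x — z × y — z

  Joined : Fin n → Fin n → Fin n → Fin n → Set
  Joined u x y z = u — x × u — y × u — z

  K₄ : Fin n → Fin n → Fin n → Fin n → Set
  K₄ x y z w = Triangle x y z × Joined w x y z

  -- v and w may be adjacent.
  K₅⁻ : Fin n → Fin n → Fin n → Fin n → Fin n → Set
  K₅⁻ x y z v w = Triangle x y z × Joined v x y z × Joined w x y z × v ≢ w

  triangle? : ∀ x y z → Dec (Triangle x y z)
  triangle? x y z = (x —? y) ×-dec (x —? z) ×-dec (y —? z)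

  joined? : ∀ u x y z → Dec (Joined u x y z)
  joined? u x y z = (u —? x) ×-dec (u —? y) ×-dec (u —? z)

  -- Of the fifteen disequalities needed for injectivity, nine come from the edges, since there are
  -- no loops, three from the `Apex` hypotheses, and the last three are assumed.
  noT : ∀ {a b c d e f} → Triangle b c e → Apex a b c e → Apex d b e c → Apex f c e b →
        a ≢ d → a ≢ f → d ≢ f → ⊥
  noT {a} {b} {c} {d} {e} {f} (bc , be , ce) (ba , ca , a≢e) (bd , ed , d≢c) (cf , ef , f≢b) a≢d a≢f d≢f =
    T-free (φ , (λ {i} {j} → VecUnique.lookup-injective distinct i j) , T-adj⇒—)
    where
    φ : Fin 6 → Fin n
    φ = Vec.lookup (a ∷ b ∷ c ∷ d ∷ e ∷ f ∷ [])
    distinct : VecUnique.Unique (a ∷ b ∷ c ∷ d ∷ e ∷ f ∷ [])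
    distinct =
      (—⇒≢ (—-sym ba) VecAll.∷ —⇒≢ (—-sym ca) VecAll.∷ a≢d VecAll.∷ a≢e VecAll.∷ a≢f VecAll.∷ VecAll.[]) VecPairs.∷
      (—⇒≢ bc VecAll.∷ —⇒≢ bd VecAll.∷ —⇒≢ be VecAll.∷ f≢b ∘ sym VecAll.∷ VecAll.[]) VecPairs.∷
      (d≢c ∘ sym VecAll.∷ —⇒≢ ce VecAll.∷ —⇒≢ cf VecAll.∷ VecAll.[]) VecPairs.∷
      (—⇒≢ (—-sym ed) VecAll.∷ d≢f VecAll.∷ VecAll.[]) VecPairs.∷
      (—⇒≢ ef VecAll.∷ VecAll.[]) VecPairs.∷
      VecAll.[] VecPairs.∷ VecPairs.[]
    images : All (λ (i , j) → φ i — φ j) T-edges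
    images = —-sym ba ∷ —-sym ca ∷ bc ∷ bd ∷ —-sym ed ∷ —-sym be ∷ cf ∷ —-sym ef ∷ ce ∷ []
    T-edge⇒— : ∀ i j → T-edge i j ≡ true → φ i — φ j
    T-edge⇒— i j ij = All.lookup images (T-edge⇒∈ i j ij)
    T-adj⇒— : ∀ i j → T-adj i j ≡ true → φ i — φ j
    T-adj⇒— i j ij with T-edge i j in eq
    ... | true  = T-edge⇒— i j eq
    ... | false = —-sym (T-edge⇒— j i ij)

  edges-split≤ : ∀ {a c r} xs ys → edges (adj G) xs ≤ a → (∀ {y} → y ∈ ys → degree (adj G) y xs ≤ c) →
                 edges (adj G) ys ≤ r → edges (adj G) (xs ++ ys) ≤ a + c * length ys + r
  edges-split≤ xs ys xs≤ d≤ ys≤ = ≤-trans (≤-reflexive (edges-++ (adj G) xs ys))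
    (+-mono-≤ (+-mono-≤ xs≤ (edgesBetween≤ xs ys d≤)) ys≤)

  degree≡0 : ∀ {u} xs → All (λ x → ¬ u — x) xs → degree (adj G) u xs ≡ 0
  degree≡0 {u} xs none = sum-map-0 xs λ {x} x∈xs → case-false x (All.lookup none x∈xs)
    where
    case-false : ∀ x → ¬ u — x → indicator (adj G u x) ≡ 0
    case-false x u≁x with adj G u x
    ... | true  = ⊥-elim (u≁x refl)
    ... | false = refl

  degree≤1 : ∀ {u} xs → AllPairs (λ x y → u — x → ¬ u — y) xs → degree (adj G) u xs ≤ 1
  degree≤1 [] [] = z≤n
  degree≤1 {u} (x ∷ xs) (x! ∷ xs!) with adj G u x
  ... | true  = ≤-reflexive (cong suc (degree≡0 xs (All.map (_$ refl) x!)))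
  ... | false = degree≤1 xs xs!

  Bounded : List (Fin n) → Set
  Bounded L = edges (adj G) L ≤ F (length L)

  Bounded-resp-↭ : ∀ {L M} → L ↭ M → Bounded M → Bounded L
  Bounded-resp-↭ p = subst₂ _≤_ (sym (edges-↭ p)) (cong F (sym (↭-length p)))

  -- Deleting a K₅ minus an edge.

  Outer : Fin n → List (Fin n) → Set
  Outer u xs = All (u ≢_) xs

  -- Otherwise the triangle `x y z` has apex `u` over `xy`, `v` over `xz` and `w` over `yz`.
  K₅⁻-xy : ∀ {x y z v w u} → K₅⁻ x y z v w → Outer u (v ∷ w ∷ x ∷ y ∷ z ∷ []) → u — x → ¬ u — y
  K₅⁻-xy ((xy , xz , yz) , (vx , vy , vz) , (wx , wy , wz) , v≢w) (u≢v ∷ u≢w ∷ u≢x ∷ u≢y ∷ u≢z ∷ []) ux uy =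
    noT (xy , xz , yz) (—-sym ux , —-sym uy , u≢z) (—-sym vx , —-sym vz , —⇒≢ vy) (—-sym wy , —-sym wz , —⇒≢ wx)
        u≢v u≢w v≢w

  -- Otherwise the triangle `x y v` has apex `w` over `xy`, `u` over `xv` and `z` over `yv`.
  K₅⁻-vx : ∀ {x y z v w u} → K₅⁻ x y z v w → Outer u (v ∷ w ∷ x ∷ y ∷ z ∷ []) → u — v → ¬ u — x
  K₅⁻-vx ((xy , xz , yz) , (vx , vy , vz) , (wx , wy , wz) , v≢w) (u≢v ∷ u≢w ∷ u≢x ∷ u≢y ∷ u≢z ∷ []) uv ux =
    noT (xy , —-sym vx , —-sym vy) (—-sym wx , —-sym wy , v≢w ∘ sym) (—-sym ux , —-sym uv , u≢y) (yz , vz , —⇒≢ xz ∘ sym)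
        (u≢w ∘ sym) (—⇒≢ wz) u≢z

  -- Otherwise the triangle `v w x` has apex `u` over `vw`, `y` over `vx` and `z` over `wx`.
  K₅⁻-vw : ∀ {x y z v w u} → K₅⁻ x y z v w → Outer u (v ∷ w ∷ x ∷ y ∷ z ∷ []) → v — w → u — v → ¬ u — w
  K₅⁻-vw ((xy , xz , yz) , (vx , vy , vz) , (wx , wy , wz) , v≢w) (u≢v ∷ u≢w ∷ u≢x ∷ u≢y ∷ u≢z ∷ []) vw uv uw =
    noT (vw , vx , wx) (—-sym uv , —-sym uw , u≢x) (vy , xy , —⇒≢ wy ∘ sym) (wz , xz , —⇒≢ vz ∘ sym)
        u≢y u≢z (—⇒≢ yz)

  K₅⁻-rotate : ∀ {x y z v w} → K₅⁻ x y z v w → K₅⁻ y z x v w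
  K₅⁻-rotate ((xy , xz , yz) , (vx , vy , vz) , (wx , wy , wz) , v≢w) =
    (yz , —-sym xy , —-sym xz) , (vy , vz , vx) , (wy , wz , wx) , v≢w

  K₅⁻-swap : ∀ {x y z v w} → K₅⁻ x y z v w → K₅⁻ x y z w v
  K₅⁻-swap (t , v , w , v≢w) = t , w , v , v≢w ∘ sym

  Outer-rotate : ∀ {u x y z v w} → Outer u (v ∷ w ∷ x ∷ y ∷ z ∷ []) → Outer u (v ∷ w ∷ y ∷ z ∷ x ∷ [])
  Outer-rotate (v ∷ w ∷ x ∷ y ∷ z ∷ []) = v ∷ w ∷ y ∷ z ∷ x ∷ []

  Outer-swap : ∀ {u x y z v w} → Outer u (v ∷ w ∷ x ∷ y ∷ z ∷ []) → Outer u (w ∷ v ∷ x ∷ y ∷ z ∷ [])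
  Outer-swap (v ∷ w ∷ xs) = w ∷ v ∷ xs

  module _ {x y z v w u} (k : K₅⁻ x y z v w) (o : Outer u (v ∷ w ∷ x ∷ y ∷ z ∷ [])) where

    private
      k′ = K₅⁻-rotate k
      o′ = Outer-rotate o
      k″ = K₅⁻-rotate k′
      o″ = Outer-rotate o′

    K₅⁻-v-xyz : All (λ a → u — v → ¬ u — a) (x ∷ y ∷ z ∷ [])
    K₅⁻-v-xyz = K₅⁻-vx k o ∷ K₅⁻-vx k′ o′ ∷ K₅⁻-vx k″ o″ ∷ []

    K₅⁻-xyz : AllPairs (λ a b → u — a → ¬ u — b) (x ∷ y ∷ z ∷ [])
    K₅⁻-xyz = (K₅⁻-xy k o ∷ (λ ux uz → K₅⁻-xy k″ o″ uz ux) ∷ []) ∷ (K₅⁻-xy k′ o′ ∷ []) ∷ [] ∷ []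

  K₅⁻-degree : ∀ {x y z v w u} → K₅⁻ x y z v w → Outer u (v ∷ w ∷ x ∷ y ∷ z ∷ []) →
               degree (adj G) u (w ∷ x ∷ y ∷ z ∷ []) ≤ 1
  K₅⁻-degree k o = degree≤1 _ (K₅⁻-v-xyz (K₅⁻-swap k) (Outer-swap o) ∷ K₅⁻-xyz k o)

  -- If `v` and `w` are adjacent, the deletion costs `10 + length R`, otherwise `9 + 2 * length R`.
  -- One outer vertex suffices to make the first cost at most the second.
  K₅⁻-step : ∀ {x y z v w} R → K₅⁻ x y z v w → Unique (v ∷ w ∷ x ∷ y ∷ z ∷ R) → 1 ≤ length R →
             edges (adj G) (v ∷ w ∷ x ∷ y ∷ z ∷ R) ≤ 9 + 2 * length R + edges (adj G) R
  K₅⁻-step {x} {y} {z} {v} {w} R k unique 1≤r with v —? w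
  ... | yes vw = ≤-trans
    (edges-split≤ (v ∷ w ∷ x ∷ y ∷ z ∷ []) R (edges≤tri (adj G) (v ∷ w ∷ x ∷ y ∷ z ∷ [])) one ≤-refl)
    (+-monoˡ-≤ _ (+-monoʳ-≤ 9 (+-mono-≤ 1≤r ≤-refl)))
    where
    one : ∀ {u} → u ∈ R → degree (adj G) u (v ∷ w ∷ x ∷ y ∷ z ∷ []) ≤ 1
    one u∈R = let o = Unique-++⇒disjoint (v ∷ w ∷ x ∷ y ∷ z ∷ []) unique u∈R in
      degree≤1 _ ((K₅⁻-vw k o vw ∷ K₅⁻-v-xyz k o) ∷ K₅⁻-v-xyz (K₅⁻-swap k) (Outer-swap o) ∷ K₅⁻-xyz k o)
  ... | no v≁w = edges-split≤ (v ∷ w ∷ x ∷ y ∷ z ∷ []) R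
    (+-mono-≤ deg-v (edges≤tri (adj G) (w ∷ x ∷ y ∷ z ∷ []))) two ≤-refl
    where
    deg-v : degree (adj G) v (w ∷ x ∷ y ∷ z ∷ []) ≤ 3
    deg-v with adj G v w
    ... | true  = ⊥-elim (v≁w refl)
    ... | false = degree≤length (adj G) v (x ∷ y ∷ z ∷ [])
    two : ∀ {u} → u ∈ R → degree (adj G) u (v ∷ w ∷ x ∷ y ∷ z ∷ []) ≤ 2
    two {u} u∈R = +-mono-≤ (indicator≤1 (adj G u v))
      (K₅⁻-degree k (Unique-++⇒disjoint (v ∷ w ∷ x ∷ y ∷ z ∷ []) unique u∈R))

  -- Deleting a K₄ when there is no K₅ minus an edge.

  K₅⁻-free : List (Fin n) → Set
  K₅⁻-free L = ∀ {x y z v w} → All (_∈ L) (v ∷ w ∷ x ∷ y ∷ z ∷ []) → ¬ K₅⁻ x y z v w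

  K₄-degree : ∀ {x y z w u} → K₄ x y z w → u ≢ x × u ≢ y × u ≢ z × u ≢ w →
              (∀ {x′ y′ z′ v′ w′} → All (_∈ u ∷ x ∷ y ∷ z ∷ w ∷ []) (v′ ∷ w′ ∷ x′ ∷ y′ ∷ z′ ∷ []) → ¬ K₅⁻ x′ y′ z′ v′ w′) →
              degree (adj G) u (x ∷ y ∷ z ∷ w ∷ []) ≤ 2
  K₄-degree {x} {y} {z} {w} {u} ((xy , xz , yz) , wx , wy , wz) (u≢x , u≢y , u≢z , u≢w) no-K₅⁻ = go
    where
    u∈ : u ∈ u ∷ x ∷ y ∷ z ∷ w ∷ []
    u∈ = here refl
    x∈ : x ∈ u ∷ x ∷ y ∷ z ∷ w ∷ []
    x∈ = there (here refl)
    y∈ : y ∈ u ∷ x ∷ y ∷ z ∷ w ∷ []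
    y∈ = there (there (here refl))
    z∈ : z ∈ u ∷ x ∷ y ∷ z ∷ w ∷ []
    z∈ = there (there (there (here refl)))
    w∈ : w ∈ u ∷ x ∷ y ∷ z ∷ w ∷ []
    w∈ = there (there (there (there (here refl))))
    go : degree (adj G) u (x ∷ y ∷ z ∷ w ∷ []) ≤ 2
    go with adj G u x in ux | adj G u y in uy | adj G u z in uz | adj G u w in uw
    -- Three neighbours of `u` in the K₄ form a triangle to which both `u` and the fourth vertex are
    -- joined.
    ... | true  | true  | true  | _     = ⊥-elim (no-K₅⁻ (u∈ ∷ w∈ ∷ x∈ ∷ y∈ ∷ z∈ ∷ [])
                                            ((xy , xz , yz) , (ux , uy , uz) , (wx , wy , wz) , u≢w))
    ... | true  | true  | false | true  = ⊥-elim (no-K₅⁻ (u∈ ∷ z∈ ∷ x∈ ∷ y∈ ∷ w∈ ∷ [])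
                                            ((xy , —-sym wx , —-sym wy) , (ux , uy , uw) , (—-sym xz , —-sym yz , —-sym wz) , u≢z))
    ... | true  | false | true  | true  = ⊥-elim (no-K₅⁻ (u∈ ∷ y∈ ∷ x∈ ∷ z∈ ∷ w∈ ∷ [])
                                            ((xz , —-sym wx , —-sym wz) , (ux , uz , uw) , (—-sym xy , yz , —-sym wy) , u≢y))
    ... | false | true  | true  | true  = ⊥-elim (no-K₅⁻ (u∈ ∷ x∈ ∷ y∈ ∷ z∈ ∷ w∈ ∷ [])
                                            ((yz , —-sym wy , —-sym wz) , (uy , uz , uw) , (xy , xz , —-sym wx) , u≢x))
    ... | true  | true  | false | false = ≤-refl
    ... | true  | false | true  | false = ≤-refl
    ... | true  | false | false | true  = ≤-refl
    ... | true  | false | false | false = m≤m+n 1 1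
    ... | false | true  | true  | false = ≤-refl
    ... | false | true  | false | true  = ≤-refl
    ... | false | true  | false | false = m≤m+n 1 1
    ... | false | false | true  | true  = ≤-refl
    ... | false | false | true  | false = m≤m+n 1 1
    ... | false | false | false | true  = m≤m+n 1 1
    ... | false | false | false | false = z≤n

  -- The cost, 6 inner edges and two per outer vertex, is exactly the increment in the recursion of
  -- `F`.
  K₄-step : ∀ {x y z w} R → K₄ x y z w → Unique (x ∷ y ∷ z ∷ w ∷ R) → K₅⁻-free (x ∷ y ∷ z ∷ w ∷ R) →
            Bounded R → Bounded (x ∷ y ∷ z ∷ w ∷ R)
  K₄-step {x} {y} {z} {w} R k unique no-K₅⁻ bounded = ≤-trans
    (edges-split≤ X R (edges≤tri (adj G) X) two bounded)
    (≤-reflexive (trans (+-comm (6 + 2 * length R) _) (cong (F (length R) +_) (+-comm 6 _))))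
    where
    X : List (Fin n)
    X = x ∷ y ∷ z ∷ w ∷ []
    two : ∀ {u} → u ∈ R → degree (adj G) u X ≤ 2
    two {u} u∈R with Unique-++⇒disjoint X unique u∈R
    ... | u≢x ∷ u≢y ∷ u≢z ∷ u≢w ∷ [] =
      K₄-degree k (u≢x , u≢y , u≢z , u≢w) (no-K₅⁻ ∘ All.map widen)
      where
      widen : ∀ {a} → a ∈ u ∷ X → a ∈ X ++ R
      widen (here refl) = ∈-++⁺ʳ X u∈R
      widen (there a∈X) = ∈-++⁺ˡ a∈X

  -- Edges in at most one triangle.

  -- "At most one common neighbour in `L`" is expressed by a single permitted exception `z`, which
  -- may be any vertex.
  LightEdge : List (Fin n) → Set
  LightEdge L = ∃₂ λ x y → x ∈ L × y ∈ L × x — y × ∃ λ z → ∀ {a} → a ∈ L → ¬ Apex a x y z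

  apex? : ∀ L x y z → Dec (∃ λ a → a ∈ L × Apex a x y z)
  apex? L x y z = ∃∈? (λ a → (x —? a) ×-dec (y —? a) ×-dec ¬? (a Fin.≟ z)) L

  K₄-free : List (Fin n) → Set
  K₄-free L = ∀ {x y z w} → All (_∈ L) (x ∷ y ∷ z ∷ w ∷ []) → ¬ K₄ x y z w

  -- Without K₄ the apexes over the three sides of a triangle are automatically distinct.
  triangle⇒LightEdge : ∀ {L x y z} → K₄-free L → x ∈ L → y ∈ L → z ∈ L → Triangle x y z → LightEdge L
  triangle⇒LightEdge {L} {x} {y} {z} no-K₄ x∈ y∈ z∈ (xy , xz , yz)
    with apex? L x y z | apex? L x z y | apex? L y z x
  ... | no none | _ | _ = x , y , x∈ , y∈ , xy , z , λ a∈ a → none (_ , a∈ , a)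
  ... | yes _ | no none | _ = x , z , x∈ , z∈ , xz , y , λ a∈ a → none (_ , a∈ , a)
  ... | yes _ | yes _ | no none = y , z , y∈ , z∈ , yz , x , λ a∈ a → none (_ , a∈ , a)
  ... | yes (a , a∈ , xya@(xa , ya , _)) | yes (d , d∈ , xzd@(xd , zd , _)) | yes (f , f∈ , yzf@(yf , zf , _)) =
    ⊥-elim (noT (xy , xz , yz) xya xzd yzf
      (λ { refl → no-K₄ (x∈ ∷ y∈ ∷ z∈ ∷ a∈ ∷ []) ((xy , xz , yz) , —-sym xa , —-sym ya , —-sym zd) })
      (λ { refl → no-K₄ (x∈ ∷ y∈ ∷ z∈ ∷ a∈ ∷ []) ((xy , xz , yz) , —-sym xa , —-sym ya , —-sym zf) })
      (λ { refl → no-K₄ (x∈ ∷ y∈ ∷ z∈ ∷ d∈ ∷ []) ((xy , xz , yz) , —-sym xd , —-sym yf , —-sym zd) }))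

  edge⇒LightEdge : ∀ {L x y} → K₄-free L → x ∈ L → y ∈ L → x — y → LightEdge L
  edge⇒LightEdge {L} {x} {y} no-K₄ x∈ y∈ xy with ∃∈? (λ a → (x —? a) ×-dec (y —? a)) L
  ... | yes (z , z∈ , xz , yz) = triangle⇒LightEdge no-K₄ x∈ y∈ z∈ (xy , xz , yz)
  -- With no common neighbour at all, the exception is a dummy, here `x`.
  ... | no none = x , y , x∈ , y∈ , xy , x , λ a∈ (xa , ya , _) → none (_ , a∈ , xa , ya)

  degrees≤length : ∀ x y R → (∀ {a} → a ∈ R → x — a → ¬ y — a) →
                   degree (adj G) x R + degree (adj G) y R ≤ length R
  degrees≤length x y []      disjoint = z≤n
  degrees≤length x y (a ∷ R) disjoint with adj G x a in xa | adj G y a in ya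
  ... | true  | true  = ⊥-elim (disjoint (here refl) xa ya)
  ... | true  | false = s≤s (degrees≤length x y R (disjoint ∘ there))
  ... | false | true  = ≤-trans (≤-reflexive (+-suc _ _)) (s≤s (degrees≤length x y R (disjoint ∘ there)))
  ... | false | false = m≤n⇒m≤1+n (degrees≤length x y R (disjoint ∘ there))

  light-degrees : ∀ {x y z} R → Unique R → (∀ {a} → a ∈ R → ¬ Apex a x y z) →
                  degree (adj G) x R + degree (adj G) y R ≤ 1 + length R
  light-degrees []      _ _ = z≤n
  light-degrees {x} {y} {z} (a ∷ R) (a∉R ∷ R!) light with adj G x a in xa | adj G y a in ya
  ... | true  | false = s≤s (light-degrees R R! (light ∘ there))
  ... | false | true  = ≤-trans (≤-reflexive (+-suc _ _)) (s≤s (light-degrees R R! (light ∘ there)))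
  ... | false | false = m≤n⇒m≤1+n (light-degrees R R! (light ∘ there))
  ... | true  | true  with a Fin.≟ z
  ...   | no a≢z = ⊥-elim (light (here refl) (xa , ya , a≢z))
  -- The exception `z` contributes 2 and uses up the extra 1. By uniqueness it does not recur in
  -- `R`, so the sharper bound for disjoint neighbourhoods applies there.
  ...   | yes refl = s≤s (≤-trans (≤-reflexive (+-suc _ _)) (s≤s (degrees≤length x y R
                       λ b∈ xb yb → light (there b∈) (xb , yb , All.lookup a∉R b∈ ∘ sym))))

  Bounded-∷ : ∀ {x y} R → x — y → degree (adj G) x R ≤ ⌊ length R /2⌋ → Bounded (y ∷ R) → Bounded (x ∷ y ∷ R)
  Bounded-∷ {x} {y} R xy d≤ bounded rewrite xy =
    ≤-trans (+-mono-≤ (s≤s d≤) bounded) (F-step₁ (length R))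

  -- An endpoint with at most half of `R` as neighbours is deleted alone; failing that, both
  -- endpoints go. Hence all three smaller bounds are assumed.
  light-step : ∀ {x y z} R → x — y → Unique R → (∀ {a} → a ∈ R → ¬ Apex a x y z) →
               Bounded (x ∷ R) → Bounded (y ∷ R) → Bounded R → Bounded (x ∷ y ∷ R)
  light-step {x} {y} R xy R! light bx by b with small-or-≤⌈/2⌉ (length R) (light-degrees R R! light)
  ... | inj₁ dx = Bounded-∷ R xy dx by
  ... | inj₂ (inj₁ dy) = Bounded-resp-↭ {x ∷ y ∷ R} (swap x y ↭-refl) (Bounded-∷ R (—-sym xy) dy bx)
  ... | inj₂ (inj₂ d≤) rewrite xy = ≤-trans
    (≤-reflexive (cong suc (sym (+-assoc (degree (adj G) x R) _ _))))
    (≤-trans (s≤s (+-mono-≤ d≤ b)) (F-step₂ (length R)))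

  edgeless : ∀ L → (∀ {x y} → x ∈ L → y ∈ L → ¬ x — y) → edges (adj G) L ≡ 0
  edgeless []      none = refl
  edgeless (x ∷ L) none =
    cong₂ _+_ (degree≡0 L (All.tabulate λ y∈ → none (here refl) (there y∈)))
              (edgeless L λ x∈ y∈ → none (there x∈) (there y∈))

  -- The two inductions on the number of vertices.

  -- `k` is fuel, since the remainders are sublists only up to permutation. Length 5 is included, so
  -- the recursion may pass through it.
  K₅⁻-free-bound : ∀ k L → length L ≤ k → Unique L → K₅⁻-free L → Bounded L
  K₅⁻-free-bound zero    []      _ _ _ = z≤n
  K₅⁻-free-bound (suc k) L len L! no-K₅⁻ with ∃∈? (λ x → ∃∈? (λ y → ∃∈? (λ z → ∃∈? (λ w →
      triangle? x y z ×-dec joined? w x y z) L) L) L) L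
  ... | yes (x , x∈ , y , y∈ , z , z∈ , w , w∈ , K) = with-K₄ (extract distinct (x∈ ∷ y∈ ∷ z∈ ∷ w∈ ∷ []))
    where
    distinct : Unique (x ∷ y ∷ z ∷ w ∷ [])
    distinct = let (xy , xz , yz) , wx , wy , wz = K in
      (—⇒≢ xy ∷ —⇒≢ xz ∷ —⇒≢ (—-sym wx) ∷ []) ∷ (—⇒≢ yz ∷ —⇒≢ (—-sym wy) ∷ []) ∷ (—⇒≢ (—-sym wz) ∷ []) ∷ [] ∷ []
    with-K₄ : (∃ λ R → L ↭ x ∷ y ∷ z ∷ w ∷ R) → Bounded L
    with-K₄ (R , p) = Bounded-resp-↭ p (K₄-step R K XR! (no-K₅⁻ ∘ All.map ∈L)
      (K₅⁻-free-bound k R shorter (Unique-++⇒Uniqueʳ X XR!) (no-K₅⁻ ∘ All.map (∈L ∘ ∈-++⁺ʳ X))))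
      where
      X : List (Fin n)
      X = x ∷ y ∷ z ∷ w ∷ []
      XR! : Unique (X ++ R)
      XR! = Unique-resp-↭ p L!
      ∈L : ∀ {a} → a ∈ X ++ R → a ∈ L
      ∈L = ∈-resp-↭ (↭-sym p)
      shorter : length R ≤ k
      shorter = ≤-pred (≤-trans (m≤n+m (1 + length R) 3) (subst (_≤ suc k) (↭-length p) len))
  ... | no no-K₄ with ∃∈? (λ x → ∃∈? (λ y → x —? y) L) L
  ...   | no none = subst (_≤ F (length L)) (sym (edgeless L λ x∈ y∈ xy → none (_ , x∈ , _ , y∈ , xy))) z≤n
  ...   | yes (x₀ , x₀∈ , y₀ , y₀∈ , x₀y₀) = with-light (edge⇒LightEdge K₄-free-L x₀∈ y₀∈ x₀y₀)
    where
    K₄-free-L : K₄-free L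
    K₄-free-L (x∈ ∷ y∈ ∷ z∈ ∷ w∈ ∷ []) K = no-K₄ (_ , x∈ , _ , y∈ , _ , z∈ , _ , w∈ , K)
    with-light : LightEdge L → Bounded L
    with-light (x , y , x∈ , y∈ , xy , z , light) with extract ((—⇒≢ xy ∷ []) ∷ [] ∷ []) (x∈ ∷ y∈ ∷ [])
    ... | R , p = Bounded-resp-↭ p (light-step R xy R! (light ∘ ∈L ∘ there ∘ there)
      (K₅⁻-free-bound k (x ∷ R) shorter xR! (no-K₅⁻ ∘ All.map (∈L ∘ x-first)))
      (K₅⁻-free-bound k (y ∷ R) shorter yR! (no-K₅⁻ ∘ All.map (∈L ∘ there)))
      (K₅⁻-free-bound k R (≤-trans (n≤1+n _) shorter) R! (no-K₅⁻ ∘ All.map (∈L ∘ there ∘ there))))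
      where
      ∈L : ∀ {a} → a ∈ x ∷ y ∷ R → a ∈ L
      ∈L = ∈-resp-↭ (↭-sym p)
      x-first : ∀ {a} → a ∈ x ∷ R → a ∈ x ∷ y ∷ R
      x-first (here a≡x)  = here a≡x
      x-first (there a∈R) = there (there a∈R)
      yR! : Unique (y ∷ R)
      yR! = Unique-++⇒Uniqueʳ (x ∷ []) (Unique-resp-↭ p L!)
      xR! : Unique (x ∷ R)
      xR! = Unique-++⇒Uniqueʳ (y ∷ []) (Unique-resp-↭ (↭-trans p (swap x y ↭-refl)) L!)
      R! : Unique R
      R! = Unique-++⇒Uniqueʳ (y ∷ []) yR!
      shorter : 1 + length R ≤ k
      shorter = ≤-pred (subst (_≤ suc k) (↭-length p) len)

  -- For `m` equal to 5 the trivial bound 10 on `r` gives 29, which is exactly `F 10`. For other `m`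
  -- the inequality reduces to `F-increasing`.
  K₅⁻-bound : ∀ m {r} → 1 ≤ m → r ≤ tri m → (m ≢ 5 → r ≤ F m) → 9 + 2 * m + r ≤ F (5 + m)
  K₅⁻-bound m {r} 1≤m r≤tri r≤F with m ℕ.≟ 5
  ... | yes refl = +-monoʳ-≤ 19 r≤tri
  ... | no m≢5 = begin
    9 + 2 * m + r               ≤⟨ +-monoʳ-≤ (9 + 2 * m) (r≤F m≢5) ⟩
    9 + 2 * m + F m             ≡⟨ rearrange m (F m) ⟩
    1 + F m + (2 * (1 + m) + 6) ≤⟨ +-monoˡ-≤ _ (F-increasing m 1≤m) ⟩
    F (5 + m)                   ∎
    where
    open ≤-Reasoning
    rearrange : ∀ m a → 9 + 2 * m + a ≡ 1 + a + (2 * (1 + m) + 6)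
    rearrange = solve-∀

  bound : ∀ k L → length L ≤ k → Unique L → length L ≢ 5 → Bounded L
  bound zero    []      _ _ _ = z≤n
  bound (suc k) L len L! len≢5 with ∃∈? (λ x → ∃∈? (λ y → ∃∈? (λ z → ∃∈? (λ v → ∃∈? (λ w →
      triangle? x y z ×-dec joined? v x y z ×-dec joined? w x y z ×-dec ¬? (v Fin.≟ w)) L) L) L) L) L
  ... | no none = K₅⁻-free-bound (suc k) L len L! λ { (v∈ ∷ w∈ ∷ x∈ ∷ y∈ ∷ z∈ ∷ []) K →
    none (_ , x∈ , _ , y∈ , _ , z∈ , _ , v∈ , _ , w∈ , K) }
  ... | yes (x , x∈ , y , y∈ , z , z∈ , v , v∈ , w , w∈ , K) =
    with-K₅⁻ (extract distinct (v∈ ∷ w∈ ∷ x∈ ∷ y∈ ∷ z∈ ∷ []))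
    where
    distinct : Unique (v ∷ w ∷ x ∷ y ∷ z ∷ [])
    distinct = let (xy , xz , yz) , (vx , vy , vz) , (wx , wy , wz) , v≢w = K in
      (v≢w ∷ —⇒≢ vx ∷ —⇒≢ vy ∷ —⇒≢ vz ∷ []) ∷ (—⇒≢ wx ∷ —⇒≢ wy ∷ —⇒≢ wz ∷ []) ∷
      (—⇒≢ xy ∷ —⇒≢ xz ∷ []) ∷ (—⇒≢ yz ∷ []) ∷ [] ∷ []
    with-K₅⁻ : (∃ λ R → L ↭ v ∷ w ∷ x ∷ y ∷ z ∷ R) → Bounded L
    -- The excluded length 5: here the graph could be K₅, with 10 edges against `F 5`, which is 8.
    with-K₅⁻ ([] , p) = ⊥-elim (len≢5 (↭-length p))
    with-K₅⁻ (R@(_ ∷ _) , p) = Bounded-resp-↭ p (≤-trans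
      (K₅⁻-step R K XR! (s≤s z≤n))
      (K₅⁻-bound (length R) (s≤s z≤n) (edges≤tri (adj G) R)
        -- The induction hypothesis is handed over still awaiting `length R ≢ 5`.
        (bound k R shorter (Unique-++⇒Uniqueʳ X XR!))))
      where
      X : List (Fin n)
      X = v ∷ w ∷ x ∷ y ∷ z ∷ []
      XR! : Unique (X ++ R)
      XR! = Unique-resp-↭ p L!
      shorter : length R ≤ k
      shorter = ≤-pred (≤-trans (m≤n+m (1 + length R) 4) (subst (_≤ suc k) (↭-length p) len))

  edgeCount≤ : n ≢ 5 → edgeCount G ≤ F n
  edgeCount≤ n≢5 = subst₂ _≤_ (sym (edgeCount≡edges G)) (cong F len)
    (bound n (allFin n) (≤-reflexive len) (allFin⁺ n) (n≢5 ∘ trans (sym len)))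
    where
    len : length (allFin n) ≡ n
    len = length-tabulate id

-- The extremal graph

-- Blocks of two alternate between the sides, so each pair `2i`, `2i + 1` lies within one side. For
-- `n` congruent to 2 modulo 4 the first `n` vertices split into `n/2 + 1` and `n/2 - 1`, which
-- accounts for the lost edge.
side : ℕ → Bool
side 0 = false
side 1 = false
side 2 = true
side 3 = true
side (suc (suc (suc (suc i)))) = side i

paired : ℕ → ℕ → Bool
paired 0 1 = true
paired 1 0 = true
paired (suc (suc i)) (suc (suc j)) = paired i j
paired _ _ = false

paired-sym : ∀ i j → paired i j ≡ paired j i
paired-sym 0 0 = refl
paired-sym 0 1 = refl
paired-sym 0 (suc (suc j)) = refl
paired-sym 1 0 = refl
paired-sym 1 1 = refl
paired-sym 1 (suc (suc j)) = refl
paired-sym (suc (suc i)) 0 = refl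
paired-sym (suc (suc i)) 1 = refl
paired-sym (suc (suc i)) (suc (suc j)) = paired-sym i j

paired-irrefl : ∀ i → paired i i ≡ false
paired-irrefl 0 = refl
paired-irrefl 1 = refl
paired-irrefl (suc (suc i)) = paired-irrefl i

paired-unique : ∀ i j k → paired i j ≡ true → paired i k ≡ true → j ≡ k
paired-unique 0 1 1 _ _ = refl
paired-unique 1 0 0 _ _ = refl
paired-unique (suc (suc i)) (suc (suc j)) (suc (suc k)) p q = cong (2 +_) (paired-unique i j k p q)

_∼_ : ℕ → ℕ → Bool
i ∼ j = (side i xor side j) ∨ paired i j

same-side⇒paired : ∀ i j → side i ≡ side j → i ∼ j ≡ true → paired i j ≡ true
same-side⇒paired i j eq ij rewrite eq | xor-same (side j) = ij

≢-≢⇒≡ : ∀ {a b c : Bool} → a ≢ b → a ≢ c → b ≡ c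
≢-≢⇒≡ a≢b a≢c = trans (¬-not (a≢b ∘ sym)) (sym (¬-not (a≢c ∘ sym)))

-- The matching partner of e would have to be an apex over both be and ce.
∼-no-T : ∀ {b c d e f} → side b ≡ side c → b ∼ c ≡ true → b ∼ e ≡ true → b ∼ d ≡ true → e ∼ d ≡ true →
         c ∼ f ≡ true → e ∼ f ≡ true → c ≢ e → c ≢ d → b ≢ f → d ≢ f → ⊥
∼-no-T {b} {c} {d} {e} {f} b≡c bc be bd ed cf ef c≢e c≢d b≢f d≢f =
  d≢f (paired-unique e d f (same-side⇒paired e d (≢-≢⇒≡ b≢e b≢d) ed)
                           (same-side⇒paired e f (≢-≢⇒≡ b≢e (c≢f ∘ trans (sym b≡c))) ef))
  where
  bc! : paired b c ≡ true
  bc! = same-side⇒paired b c b≡c bc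
  b≢e : side b ≢ side e
  b≢e eq = c≢e (paired-unique b c e bc! (same-side⇒paired b e eq be))
  b≢d : side b ≢ side d
  b≢d eq = c≢d (paired-unique b c d bc! (same-side⇒paired b d eq bd))
  c≢f : side c ≢ side f
  c≢f eq = b≢f (paired-unique c b f (trans (paired-sym c b) bc!) (same-side⇒paired c f eq cf))

extremal : ∀ n → Graph n
extremal n .adj i j = toℕ i ∼ toℕ j
extremal n .adj-sym i j = cong₂ _∨_ (xor-comm (side (toℕ i)) _) (paired-sym (toℕ i) _)
extremal n .irref i = cong₂ _∨_ (xor-same (side (toℕ i))) (paired-irrefl (toℕ i))

extremal-T-free : ∀ n → T ⊆ᴳ extremal n → ⊥
extremal-T-free n (φ , φ-inj , φ-adj) = case
  where
  v : Fin 6 → ℕ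
  v = toℕ ∘ φ
  distinct : ∀ {i j} → i ≢ j → v i ≢ v j
  distinct i≢j = i≢j ∘ φ-inj ∘ Fin.toℕ-injective
  case : ⊥
  -- Two of the three vertices of the inner triangle share a side; by the symmetry of `T` they take
  -- the roles of `b` and `c`.
  case with side (v 1F) ≟ side (v 2F) | side (v 1F) ≟ side (v 4F)
  ... | yes 1≡2 | _ = ∼-no-T 1≡2 (φ-adj 1F 2F refl) (φ-adj 1F 4F refl) (φ-adj 1F 3F refl) (φ-adj 4F 3F refl)
    (φ-adj 2F 5F refl) (φ-adj 4F 5F refl) (distinct λ ()) (distinct λ ()) (distinct λ ()) (distinct λ ())
  ... | no _ | yes 1≡4 = ∼-no-T 1≡4 (φ-adj 1F 4F refl) (φ-adj 1F 2F refl) (φ-adj 1F 0F refl) (φ-adj 2F 0F refl)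
    (φ-adj 4F 5F refl) (φ-adj 2F 5F refl) (distinct λ ()) (distinct λ ()) (distinct λ ()) (distinct λ ())
  ... | no 1≢2 | no 1≢4 = ∼-no-T (≢-≢⇒≡ 1≢2 1≢4) (φ-adj 2F 4F refl) (φ-adj 2F 1F refl) (φ-adj 2F 0F refl)
    (φ-adj 1F 0F refl) (φ-adj 4F 3F refl) (φ-adj 1F 3F refl) (distinct λ ()) (distinct λ ()) (distinct λ ()) (distinct λ ())

-- Counting the edges of the extremal graph.

first-four : List ℕ
first-four = 0 ∷ 1 ∷ 2 ∷ 3 ∷ []

edgesBetween-first-four : ∀ is → edgesBetween _∼_ first-four (map (4 +_) is) ≡ 2 * length is
edgesBetween-first-four []       = refl
edgesBetween-first-four (i ∷ is) = begin
  edgesBetween _∼_ first-four (map (4 +_) (i ∷ is))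
    ≡⟨ edgesBetween-∷ _∼_ first-four (4 + i) (map (4 +_) is) ⟩
  sum (map (λ x → indicator (x ∼ (4 + i))) first-four) + edgesBetween _∼_ first-four (map (4 +_) is)
    ≡⟨ cong₂ _+_ two (edgesBetween-first-four is) ⟩
  2 + 2 * length is
    ≡⟨ *-suc 2 (length is) ⟨
  2 * suc (length is) ∎
  where
  open ≡-Reasoning
  -- Each side holds two of the first four vertices, and no matching edge leaves this block.
  two : sum (map (λ x → indicator (x ∼ (4 + i))) first-four) ≡ 2
  two with side i
  ... | true  = refl
  ... | false = refl

edges-∼ : ∀ n → edges _∼_ (tabulate {n = n} toℕ) ≡ F n
edges-∼ 0 = refl
edges-∼ 1 = refl
edges-∼ 2 = refl
edges-∼ 3 = refl
edges-∼ (suc (suc (suc (suc n)))) = begin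
  edges _∼_ (first-four ++ tabulate {n = n} (λ i → 4 + toℕ i))
    ≡⟨ cong (λ l → edges _∼_ (first-four ++ l)) (map-tabulate {n = n} toℕ (4 +_)) ⟨
  edges _∼_ (first-four ++ map (4 +_) is)
    ≡⟨ edges-++ _∼_ first-four (map (4 +_) is) ⟩
  -- The first four vertices induce a K₄. Below, the shift by 4 disappears because `_∼_` is
  -- invariant under it by computation.
  6 + edgesBetween _∼_ first-four (map (4 +_) is) + edges _∼_ (map (4 +_) is)
    ≡⟨ cong₂ (λ b e → 6 + b + e) (edgesBetween-first-four is) (edges-map _∼_ (4 +_) is) ⟩
  6 + 2 * length is + edges _∼_ is
    ≡⟨ cong₂ (λ l e → 6 + 2 * l + e) (length-tabulate {n = n} toℕ) (edges-∼ n) ⟩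
  6 + 2 * n + F n
    ≡⟨ trans (+-comm (6 + 2 * n) (F n)) (cong (F n +_) (+-comm 6 (2 * n))) ⟩
  F n + (2 * n + 6) ∎
  where
  open ≡-Reasoning
  is : List ℕ
  is = tabulate {n = n} toℕ

edgeCount-extremal : ∀ n → edgeCount (extremal n) ≡ F n
edgeCount-extremal n = begin
  edgeCount (extremal n)                   ≡⟨ edgeCount≡edges (extremal n) ⟩
  edges (adj (extremal n)) (allFin n)      ≡⟨ edges-map _∼_ toℕ (allFin n) ⟨
  edges _∼_ (map toℕ (allFin n))           ≡⟨ cong (edges _∼_) (map-tabulate {n = n} id toℕ) ⟩
  edges _∼_ (tabulate {n = n} toℕ)             ≡⟨ edges-∼ n ⟩
  F n                                      ∎
  where open ≡-Reasoning

theorem5 : (n : ℕ) → 1 ≤ n → n ≢ 5 → IsEx n T (exT n)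
theorem5 n _ n≢5 =
  (extremal n , extremal-T-free n , trans (edgeCount-extremal n) (F≡exT n)) ,
  λ G T-free → subst (edgeCount G ≤_) (F≡exT n) (UpperBound.edgeCount≤ G T-free n≢5)
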